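{- Let $k\ge 1$ be an integer and let $(P_{k,n})_{n\ge0}$ be the generalized $k$-Pell-Tribonacci sequence. For every integer $n\geq 0$, $$\sum_{i=0}^{n}iP_{k,i}^2=\frac{a_1P_{k,n+3}^2+a_2P_{k,n+2}^2+a_3P_{k,n+1}^2}{9k^2(k+2)^2}+\frac{b_1P_{k,n+1}P_{k,n+2}+b_2P_{k,n+2}P_{k,n+3}+b_3P_{k,n+1}P_{k,n+3}+c_1}{9k^2(k+2)^2},$$ where $$\begin{aligned} a_1&=-3k(k+2)n-(7k^2+14k+9),\\ a_2&=-3k(k+2)(2k+1)^2n-(28k^4+72k^3+60k^2+20k+9),\\ a_3&=-3k(k+2)(3k^2+6k+1)n-(9k^4+36k^3+46k^2+20k+9),\\ b_1&=-6k(k+2)(k-1)n-(20k^3+20k^2-16k-6),\\ b_2&=6k(k+2)(2k+1)n+(28k^3+64k^2+46k+6),\\ b_3&=6k(k+2)n+(14k^2+22k+6),\\ c_1&=k^2+2k+9. \end{aligned}$$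
   Context: For an integer $k\geq 1$, the generalized $k$-Pell-Tribonacci sequence $(P_{k,n})_{n\ge 0}$ is defined by $P_{k,0}=0$, $P_{k,1}=1$, $P_{k,2}=2k$ and $P_{k,n}=2kP_{k,n-1}+kP_{k,n-2}+P_{k,n-3}$ for $n\geq 3$. -}

module Defs where

open import Agda.Builtin.FromNat using (Number; fromNat)
open import Agda.Builtin.FromNeg using (Negative; fromNeg)
open import Data.Integer.Base using (ℤ; _+_; _*_; _-_; _^_)
import Data.Integer.Literals as ℤLiterals
open import Data.List.Base using (map; upTo)
open import Data.Nat.Base as ℕ using (ℕ; zero; suc; NonZero)
open import Data.Nat.ListAction using (sum)
import Data.Nat.Literals as ℕLiterals
open import Data.Nat.Properties using (m*n≢0; m^n≢0)
open import Data.Unit.Base using (⊤)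

private
  instance
    ℕ-number : Number ℕ
    ℕ-number = ℕLiterals.number

    ℤ-number : Number ℤ
    ℤ-number = ℤLiterals.number

    ℤ-negative : Negative ℤ
    ℤ-negative = ℤLiterals.negative

P : ℕ → ℕ → ℕ
P k zero                = 0
P k (suc zero)          = 1
P k (suc (suc zero))    = 2 ℕ.* k
P k (suc (suc (suc n))) =
  2 ℕ.* k ℕ.* P k (suc (suc n)) ℕ.+ k ℕ.* P k (suc n) ℕ.+ P k n

-- The range is 0 ≤ i ≤ n: upTo (suc n) lists 0 , … , n.
weightedSquareSum : ℕ → ℕ → ℕ
weightedSquareSum k n = sum (map (λ i → i ℕ.* P k i ℕ.^ 2) (upTo (suc n)))

a₁ a₂ a₃ b₁ b₂ b₃ : ℤ → ℤ → ℤ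
a₁ k n = -3 * k * (k + 2) * n - (7 * k ^ 2 + 14 * k + 9)
a₂ k n = -3 * k * (k + 2) * (2 * k + 1) ^ 2 * n
         - (28 * k ^ 4 + 72 * k ^ 3 + 60 * k ^ 2 + 20 * k + 9)
a₃ k n = -3 * k * (k + 2) * (3 * k ^ 2 + 6 * k + 1) * n
         - (9 * k ^ 4 + 36 * k ^ 3 + 46 * k ^ 2 + 20 * k + 9)
b₁ k n = -6 * k * (k + 2) * (k - 1) * n
         - (20 * k ^ 3 + 20 * k ^ 2 - 16 * k - 6)
b₂ k n = 6 * k * (k + 2) * (2 * k + 1) * n
         + (28 * k ^ 3 + 64 * k ^ 2 + 46 * k + 6)
b₃ k n = 6 * k * (k + 2) * n + (14 * k ^ 2 + 22 * k + 6)

c₁ : ℤ → ℤ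
c₁ k = k ^ 2 + 2 * k + 9

denominator : ℕ → ℕ
denominator k = 9 ℕ.* k ℕ.^ 2 ℕ.* (k ℕ.+ 2) ℕ.^ 2

-- Not an instance: denominator unfolds, so instance search for NonZero would
-- try it on every goal.
denominator-nonZero : ∀ k .{{_ : NonZero k}} → NonZero (denominator k)
denominator-nonZero k =
  m*n≢0 (9 ℕ.* k ℕ.^ 2) ((k ℕ.+ 2) ℕ.^ 2)
    {{m*n≢0 9 (k ℕ.^ 2) {{_}} {{m^n≢0 k 2}}}}
    {{m^n≢0 (k ℕ.+ 2) 2 {{ℕ.>-nonZero (k+2>0 k)}}}}
  where
  k+2>0 : ∀ k → k ℕ.+ 2 ℕ.> 0
  k+2>0 zero    = ℕ.z<s
  k+2>0 (suc _) = ℕ.z<s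

{-# OPTIONS --safe #-}

-- The numerator on the right is a quadratic form in the window
-- (P n+1 , P n+2 , P n+3).  Sliding the window by one step of the recurrence
-- changes it by exactly (n+1) P n+1 ² times the denominator, a polynomial
-- identity in k, n and the three entries of the window; the sum telescopes.
module Submission where

open import Defs
open import Data.Integer.Base using (+_; _+_; _*_; _^_)
open import Data.Nat.Base as ℕ using (ℕ; NonZero)
open import Data.Rational.Base as ℚ using (_/_)
open import Relation.Binary.PropositionalEquality using (_≡_)

open import Data.Integer.Base using (ℤ; -[1+_]; 0ℤ; 1ℤ)
import Data.Integer.Properties as ℤ
open import Data.Integer.Solver using (module +-*-Solver)
open import Data.List.Base using (upTo; map; _∷ʳ_)
open import Data.List.Properties using (map-++; upTo-∷ʳ)
open import Data.Nat.Base using (zero; suc)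
open import Data.Nat.ListAction using (sum)
open import Data.Nat.ListAction.Properties using (sum-++)
import Data.Nat.Properties as ℕ
open import Data.Rational.Properties as ℚ using (toℚᵘ-homo-+; toℚᵘ-fromℚᵘ)
open import Data.Rational.Unnormalised.Base as ℚᵘ using (mkℚᵘ; *≡*)
import Data.Rational.Unnormalised.Properties as ℚᵘ
open import Relation.Binary.PropositionalEquality
  using (refl; sym; trans; cong; cong₂; module ≡-Reasoning)
open +-*-Solver

denominatorℤ : ℤ → ℤ
denominatorℤ k = + 9 * k ^ 2 * (k + + 2) ^ 2

-- The two halves mirror the two fractions of the theorem. The window `x`, `y`, `z` is kept free and
-- listed oldest entry first.
squareTerms crossTerms numerator : ℤ → ℤ → ℤ → ℤ → ℤ → ℤ
squareTerms k n x y z = a₁ k n * z ^ 2 + a₂ k n * y ^ 2 + a₃ k n * x ^ 2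
crossTerms k n x y z = b₁ k n * x * y + b₂ k n * y * z + b₃ k n * x * z + c₁ k
numerator k n x y z = squareTerms k n x y z + crossTerms k n x y z

-- The ring solver cannot look inside a₁, …, c₁, so they are restated in its
-- syntax; that they evaluate to the originals is checked by conversion at each
-- use of solve.
module Syntax {m : ℕ} where
  lit : ℕ → Polynomial m
  lit i = con (+ i)

  α₁ α₂ α₃ β₁ β₂ β₃ : Polynomial m → Polynomial m → Polynomial m
  α₁ k n = con -[1+ 2 ] :* k :* (k :+ lit 2) :* n
           :- (lit 7 :* k :^ 2 :+ lit 14 :* k :+ lit 9)
  α₂ k n = con -[1+ 2 ] :* k :* (k :+ lit 2) :* (lit 2 :* k :+ lit 1) :^ 2 :* n
           :- (lit 28 :* k :^ 4 :+ lit 72 :* k :^ 3 :+ lit 60 :* k :^ 2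
               :+ lit 20 :* k :+ lit 9)
  α₃ k n = con -[1+ 2 ] :* k :* (k :+ lit 2)
             :* (lit 3 :* k :^ 2 :+ lit 6 :* k :+ lit 1) :* n
           :- (lit 9 :* k :^ 4 :+ lit 36 :* k :^ 3 :+ lit 46 :* k :^ 2
               :+ lit 20 :* k :+ lit 9)
  β₁ k n = con -[1+ 5 ] :* k :* (k :+ lit 2) :* (k :- lit 1) :* n
           :- (lit 20 :* k :^ 3 :+ lit 20 :* k :^ 2 :- lit 16 :* k :- lit 6)
  β₂ k n = lit 6 :* k :* (k :+ lit 2) :* (lit 2 :* k :+ lit 1) :* n
           :+ (lit 28 :* k :^ 3 :+ lit 64 :* k :^ 2 :+ lit 46 :* k :+ lit 6)
  β₃ k n = lit 6 :* k :* (k :+ lit 2) :* n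
           :+ (lit 14 :* k :^ 2 :+ lit 22 :* k :+ lit 6)

  γ₁ δ : Polynomial m → Polynomial m
  γ₁ k = k :^ 2 :+ lit 2 :* k :+ lit 9
  δ k = lit 9 :* k :^ 2 :* (k :+ lit 2) :^ 2

  ν : (k n x y z : Polynomial m) → Polynomial m
  ν k n x y z =
    (α₁ k n :* z :^ 2 :+ α₂ k n :* y :^ 2 :+ α₃ k n :* x :^ 2)
    :+ (β₁ k n :* x :* y :+ β₂ k n :* y :* z :+ β₃ k n :* x :* z :+ γ₁ k)

open Syntax

next : ℤ → ℤ → ℤ → ℤ → ℤ
next k x y z = + 2 * k * z + k * y + x

-- Holds for arbitrary integers `x`, `y`, `z`: the recurrence enters only through `next`, and `c₁ k`
-- cancels between the two sides.
numerator-step : ∀ k n x y z →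
  numerator k n x y z + (1ℤ + n) * x ^ 2 * denominatorℤ k
  ≡ numerator k (1ℤ + n) y z (next k x y z)
numerator-step = solve 5 (λ k n x y z →
  ν k n x y z :+ (lit 1 :+ n) :* x :^ 2 :* δ k
  := ν k (lit 1 :+ n) y z (lit 2 :* k :* z :+ k :* y :+ x)) refl

-- Starts the telescoping: the window for the empty weight n = 0 is 1, 2k, 4k² + k. Since the
-- sliding step does not see `c₁`, this identity is what fixes its value.
numerator-initial : ∀ k →
  0ℤ ≡ numerator k 0ℤ 1ℤ (+ 2 * k) (next k 0ℤ 1ℤ (+ 2 * k))
numerator-initial = solve 1 (λ k →
  lit 0 := ν k (lit 0) (lit 1) (lit 2 :* k)
             (lit 2 :* k :* (lit 2 :* k) :+ k :* lit 1 :+ lit 0)) refl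

pos-^ : ∀ m n → + (m ℕ.^ n) ≡ (+ m) ^ n
pos-^ m zero    = refl
pos-^ m (suc n) = trans (ℤ.pos-* m (m ℕ.^ n)) (cong (+ m *_) (pos-^ m n))

pos-denominator : ∀ k → + denominator k ≡ denominatorℤ (+ k)
pos-denominator k = begin
  + (9 ℕ.* k ℕ.^ 2 ℕ.* (k ℕ.+ 2) ℕ.^ 2)
    ≡⟨ ℤ.pos-* (9 ℕ.* k ℕ.^ 2) _ ⟩
  + (9 ℕ.* k ℕ.^ 2) * + ((k ℕ.+ 2) ℕ.^ 2)
    ≡⟨ cong₂ _*_ (ℤ.pos-* 9 (k ℕ.^ 2)) (pos-^ (k ℕ.+ 2) 2) ⟩
  + 9 * + (k ℕ.^ 2) * (+ k + + 2) ^ 2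
    ≡⟨ cong (λ x → + 9 * x * (+ k + + 2) ^ 2) (pos-^ k 2) ⟩
  denominatorℤ (+ k) ∎
  where open ≡-Reasoning

-- `+_` commutes with sums by computation, so only the two products need rewriting.
pos-P-recurrence : ∀ k n →
  + P k (3 ℕ.+ n) ≡ next (+ k) (+ P k n) (+ P k (1 ℕ.+ n)) (+ P k (2 ℕ.+ n))
pos-P-recurrence k n = cong (_+ + P k n) (cong₂ _+_
  (trans (ℤ.pos-* (2 ℕ.* k) (P k (2 ℕ.+ n)))
         (cong (_* + P k (2 ℕ.+ n)) (ℤ.pos-* 2 k)))
  (ℤ.pos-* k (P k (1 ℕ.+ n))))

-- `upTo` unfolds from the front, whereas the telescoping needs the last term split off.
weightedSquareSum-suc : ∀ k n →
  weightedSquareSum k (suc n)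
  ≡ weightedSquareSum k n ℕ.+ suc n ℕ.* P k (suc n) ℕ.^ 2
weightedSquareSum-suc k n = begin
  sum (map f (upTo (2 ℕ.+ n)))        ≡⟨ cong (λ is → sum (map f is)) (upTo-∷ʳ (suc n)) ⟨
  sum (map f (upTo (suc n) ∷ʳ suc n)) ≡⟨ cong sum (map-++ f (upTo (suc n)) _) ⟩
  sum (map f (upTo (suc n)) ∷ʳ f (suc n))
    ≡⟨ sum-++ (map f (upTo (suc n))) _ ⟩
  weightedSquareSum k n ℕ.+ (f (suc n) ℕ.+ 0)
    ≡⟨ cong (weightedSquareSum k n ℕ.+_) (ℕ.+-identityʳ (f (suc n))) ⟩
  weightedSquareSum k n ℕ.+ f (suc n) ∎
  where
  open ≡-Reasoning
  f : ℕ → ℕ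
  f i = i ℕ.* P k i ℕ.^ 2

-- The denominator is cleared so that the induction on `n` stays in ℤ, where the ring solver
-- applies.
weightedSquareSum-closed : ∀ k n →
  + weightedSquareSum k n * denominatorℤ (+ k)
  ≡ numerator (+ k) (+ n) (+ P k (1 ℕ.+ n)) (+ P k (2 ℕ.+ n)) (+ P k (3 ℕ.+ n))
weightedSquareSum-closed k zero = begin
  0ℤ * denominatorℤ (+ k)
    ≡⟨ ℤ.*-zeroˡ (denominatorℤ (+ k)) ⟩
  0ℤ
    ≡⟨ numerator-initial (+ k) ⟩
  numerator (+ k) 0ℤ 1ℤ (+ 2 * + k) (next (+ k) 0ℤ 1ℤ (+ 2 * + k))
    ≡⟨ cong (λ y → numerator (+ k) 0ℤ 1ℤ y (next (+ k) 0ℤ 1ℤ y)) (ℤ.pos-* 2 k) ⟨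
  numerator (+ k) 0ℤ 1ℤ (+ P k 2) (next (+ k) 0ℤ 1ℤ (+ P k 2))
    ≡⟨ cong (numerator (+ k) 0ℤ 1ℤ (+ P k 2)) (pos-P-recurrence k 0) ⟨
  numerator (+ k) 0ℤ 1ℤ (+ P k 2) (+ P k 3) ∎
  where open ≡-Reasoning
weightedSquareSum-closed k (suc n) = begin
  + weightedSquareSum k (suc n) * D
    ≡⟨ cong (λ s → + s * D) (weightedSquareSum-suc k n) ⟩
  (+ weightedSquareSum k n + + (suc n ℕ.* P k (suc n) ℕ.^ 2)) * D
    ≡⟨ cong (λ t → (+ weightedSquareSum k n + t) * D)
         (trans (ℤ.pos-* (suc n) (P k (suc n) ℕ.^ 2)) (cong (+ suc n *_) (pos-^ (P k (suc n)) 2))) ⟩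
  (+ weightedSquareSum k n + + suc n * x ^ 2) * D
    ≡⟨ ℤ.*-distribʳ-+ D (+ weightedSquareSum k n) (+ suc n * x ^ 2) ⟩
  + weightedSquareSum k n * D + + suc n * x ^ 2 * D
    ≡⟨ cong (_+ + suc n * x ^ 2 * D) (weightedSquareSum-closed k n) ⟩
  numerator (+ k) (+ n) x y z + + suc n * x ^ 2 * D
    -- `1ℤ + + n` computes to `+ suc n`, so the identity applies as it stands.
    ≡⟨ numerator-step (+ k) (+ n) x y z ⟩
  numerator (+ k) (+ suc n) y z (next (+ k) x y z)
    ≡⟨ cong (numerator (+ k) (+ suc n) y z) (pos-P-recurrence k (suc n)) ⟨
  numerator (+ k) (+ suc n) y z (+ P k (4 ℕ.+ n)) ∎
  where
  open ≡-Reasoning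
  D x y z : ℤ
  D = denominatorℤ (+ k)
  x = + P k (1 ℕ.+ n)
  y = + P k (2 ℕ.+ n)
  z = + P k (3 ℕ.+ n)

-- Normalised fractions hide their numerators behind a gcd; among unnormalised ones, equality is
-- plain cross-multiplication.
/1≡/d+/d : ∀ s i j d .{{_ : NonZero d}} →
  s * + d ≡ i + j → s / 1 ≡ i / d ℚ.+ j / d
/1≡/d+/d s i j d@(suc d-1) s*d≡i+j = ℚ.toℚᵘ-injective (begin
  ℚ.toℚᵘ (s / 1)                      ≈⟨ toℚᵘ-fromℚᵘ (mkℚᵘ s 0) ⟩
  mkℚᵘ s 0                            ≈⟨ *≡* cross ⟩
  mkℚᵘ i d-1 ℚᵘ.+ mkℚᵘ j d-1
    ≈⟨ ℚᵘ.+-cong (toℚᵘ-fromℚᵘ (mkℚᵘ i d-1)) (toℚᵘ-fromℚᵘ (mkℚᵘ j d-1)) ⟨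
  ℚ.toℚᵘ (i / d) ℚᵘ.+ ℚ.toℚᵘ (j / d) ≈⟨ toℚᵘ-homo-+ (i / d) (j / d) ⟨
  ℚ.toℚᵘ (i / d ℚ.+ j / d)            ∎)
  where
  open import Relation.Binary.Reasoning.Setoid ℚᵘ.≃-setoid
  -- Unnormalised addition multiplies the denominators even when they agree, so the hypothesis is
  -- used multiplied by a further `d`.
  cross : s * + (d ℕ.* d) ≡ (i * + d + j * + d) * 1ℤ
  cross = ≡.begin
    s * (+ (d ℕ.* d))          ≡.≡⟨ cong (s *_) (ℤ.pos-* d d) ⟩
    s * (+ d * + d)            ≡.≡⟨ ℤ.*-assoc s (+ d) (+ d) ⟨
    s * + d * + d              ≡.≡⟨ cong (_* + d) s*d≡i+j ⟩
    (i + j) * + d              ≡.≡⟨ ℤ.*-distribʳ-+ (+ d) i j ⟩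
    i * + d + j * + d          ≡.≡⟨ ℤ.*-identityʳ _ ⟨
    (i * + d + j * + d) * 1ℤ   ≡.∎
    where module ≡ = ≡-Reasoning

proposition5 : (k : ℕ) .{{_ : NonZero k}} (n : ℕ) →
    let K  = + k
        N  = + n
        P₁ = + P k (n ℕ.+ 1)
        P₂ = + P k (n ℕ.+ 2)
        P₃ = + P k (n ℕ.+ 3)
        _/D = λ z → (z / denominator k) {{denominator-nonZero k}}
    in
    (+ weightedSquareSum k n) / 1
      ≡ (a₁ K N * P₃ ^ 2 + a₂ K N * P₂ ^ 2 + a₃ K N * P₁ ^ 2) /D
        ℚ.+ (b₁ K N * P₁ * P₂ + b₂ K N * P₂ * P₃ + b₃ K N * P₁ * P₃ + c₁ K) /D
proposition5 k n
  -- `n ℕ.+ 1` is stuck on `n`; the flipped indices are those of the integer identity.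
  rewrite ℕ.+-comm n 1 | ℕ.+-comm n 2 | ℕ.+-comm n 3 =
  /1≡/d+/d (+ weightedSquareSum k n)
    (squareTerms (+ k) (+ n) (+ P k (1 ℕ.+ n)) (+ P k (2 ℕ.+ n)) (+ P k (3 ℕ.+ n)))
    (crossTerms (+ k) (+ n) (+ P k (1 ℕ.+ n)) (+ P k (2 ℕ.+ n)) (+ P k (3 ℕ.+ n)))
    (denominator k) {{denominator-nonZero k}}
    (trans (cong (+ weightedSquareSum k n *_) (pos-denominator k))
           (weightedSquareSum-closed k n))
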